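{- Let $\mathbb{F}_q$ be a finite field with $q\equiv 1\pmod 3$ and let $\rho\in\mathbb{F}_q$ be a primitive cube root of unity. The family of elliptic curves $$E_a:\ y^2+(3a-1)xy+a(\rho-1)\Bigl(a-\frac{\rho+1}{3}\Bigr)y=x^3,\qquad a\in\mathbb{F}_q,\quad a\Bigl(a-\frac{\rho+1}{3}\Bigr)\Bigl(a-\frac{\rho}{3}\Bigr)\neq 0,$$ corresponds to all the elliptic curves defined over $\mathbb{F}_q$ with non-cyclic $3$-torsion subgroup; that is, each such $E_a$ is an elliptic curve with $E_a(\mathbb{F}_q)[3]$ non-cyclic, and every elliptic curve $E$ over $\mathbb{F}_q$ with $E(\mathbb{F}_q)[3]$ non-cyclic is isomorphic over $\mathbb{F}_q$ to some $E_a$ in the family. -}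

module Defs where

open import Algebra.Bundles using (CommutativeRing; RawGroup; Semiring)
import Algebra.Definitions.RawMonoid as RawMonoidDefinitions
import Algebra.Definitions.RawSemiring as RawSemiringDefinitions
import Algebra.Properties.Ring as RingProperties
import Algebra.Properties.AbelianGroup as AbelianGroupProperties
import Algebra.Properties.Semiring.Mult.TCOptimised as Multiples
import Algebra.Solver.Ring as RingSolver
open import Algebra.Solver.Ring.AlmostCommutativeRing
  using (_-Raw-AlmostCommutative⟶_; fromCommutativeRing)
open import Data.Fin.Base using (Fin)
import Data.Fin.Properties as Fin
open import Data.Integer.Base as ℤ using (ℤ; +_; -[1+_]; _⊖_)
import Data.Integer.Properties as ℤ
open import Data.Maybe.Base using (Maybe; just; nothing)
open import Data.Nat.Base as ℕ using (ℕ; zero; suc)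
open import Data.Product.Base using (∃-syntax; _×_; _,_; proj₁; proj₂)
open import Function.Bundles using (Inverse)
open import Function.Properties.Inverse using (Inverse⇒Injection)
open import Level using (Level; _⊔_) renaming (suc to lsuc)
open import Relation.Binary.Definitions using (Decidable)
open import Relation.Binary.PropositionalEquality as ≡ using (_≡_)
import Relation.Binary.Reasoning.Setoid as SetoidReasoning
open import Relation.Nullary using (¬_; yes; no; contradiction)
open import Relation.Nullary.Decidable using (via-injection)

------------------------------------------------------------------------
-- Cyclic and torsion subsets of a group

module GroupTheory {g ℓ : Level} (G : RawGroup g ℓ) where

  open RawGroup G
  open RawMonoidDefinitions rawMonoid public using () renaming (_×_ to _·_)

  infixr 8 _·ᶻ_

  _·ᶻ_ : ℤ → Carrier → Carrier
  (+ n)    ·ᶻ x = n · x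
  -[1+ n ] ·ᶻ x = (suc n · x) ⁻¹

  Torsion : ℕ → Carrier → Set ℓ
  Torsion n x = n · x ≈ ε

  Cyclic : ∀ {p} → (Carrier → Set p) → Set (g ⊔ ℓ ⊔ p)
  Cyclic S = ∃[ x ] (S x × (∀ y → S y → ∃[ k ] y ≈ k ·ᶻ x))

------------------------------------------------------------------------
-- Polynomial identities in commutative rings, with integer coefficients

module IntegerSolver {c ℓ : Level} (R : CommutativeRing c ℓ) where

  open CommutativeRing R
  open RingProperties ring
  open AbelianGroupProperties +-abelianGroup using (⁻¹-∙-comm)
  open Multiples semiring using (×-homo-+; ×1-homo-*; 1+×) renaming (_×_ to _×′_)
  open SetoidReasoning setoid

  ⟦_⟧ℤ : ℤ → Carrier
  ⟦ + n      ⟧ℤ = n ×′ 1#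
  ⟦ -[1+ n ] ⟧ℤ = - (suc n ×′ 1#)

  private
    cancel-+ : ∀ x y z → (x + y) - (x + z) ≈ y - z
    cancel-+ x y z = begin
      (x + y) + - (x + z)     ≈⟨ +-cong (+-comm x y) (sym (⁻¹-∙-comm x z)) ⟩
      (y + x) + (- x + - z)   ≈⟨ +-assoc y x _ ⟩
      y + (x + (- x + - z))   ≈⟨ +-congˡ (+-assoc x (- x) (- z)) ⟨
      y + ((x - x) + - z)     ≈⟨ +-congˡ (+-congʳ (-‿inverseʳ x)) ⟩
      y + (0# + - z)          ≈⟨ +-congˡ (+-identityˡ (- z)) ⟩
      y - z                   ∎

    -- m ⊖ n is the integer m - n
    ⊖-homo : ∀ m n → ⟦ m ⊖ n ⟧ℤ ≈ m ×′ 1# - n ×′ 1#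
    ⊖-homo zero    zero    = sym (-‿inverseʳ 0#)
    ⊖-homo zero    (suc n) = sym (+-identityˡ _)
    ⊖-homo (suc m) zero    = sym (trans (+-congˡ -0#≈0#) (+-identityʳ _))
    ⊖-homo (suc m) (suc n) = begin
      ⟦ suc m ⊖ suc n ⟧ℤ                 ≡⟨ ≡.cong ⟦_⟧ℤ (ℤ.[1+m]⊖[1+n]≡m⊖n m n) ⟩
      ⟦ m ⊖ n ⟧ℤ                         ≈⟨ ⊖-homo m n ⟩
      m ×′ 1# - n ×′ 1#                  ≈⟨ cancel-+ 1# _ _ ⟨
      (1# + m ×′ 1#) - (1# + n ×′ 1#)    ≈⟨ +-cong (1+× m 1#) (-‿cong (1+× n 1#)) ⟨
      suc m ×′ 1# - suc n ×′ 1#          ∎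

    neg-homo : ∀ i → ⟦ ℤ.- i ⟧ℤ ≈ - ⟦ i ⟧ℤ
    neg-homo (+ zero)  = sym -0#≈0#
    neg-homo (+ suc n) = refl
    neg-homo -[1+ n ]  = sym (-‿involutive _)

    +-homo : ∀ i j → ⟦ i ℤ.+ j ⟧ℤ ≈ ⟦ i ⟧ℤ + ⟦ j ⟧ℤ
    +-homo (+ m)    (+ n)    = ×-homo-+ 1# m n
    +-homo (+ m)    -[1+ n ] = ⊖-homo m (suc n)
    +-homo -[1+ m ] (+ n)    = trans (⊖-homo n (suc m)) (+-comm _ _)
    +-homo -[1+ m ] -[1+ n ] = begin
      ⟦ -[1+ m ] ℤ.+ -[1+ n ] ⟧ℤ        ≡⟨ ≡.cong ⟦_⟧ℤ (ℤ.neg-distrib-+ (+ suc m) (+ suc n)) ⟨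
      ⟦ ℤ.- (+ (suc m ℕ.+ suc n)) ⟧ℤ    ≈⟨ neg-homo (+ (suc m ℕ.+ suc n)) ⟩
      - ((suc m ℕ.+ suc n) ×′ 1#)       ≈⟨ -‿cong (×-homo-+ 1# (suc m) (suc n)) ⟩
      - (suc m ×′ 1# + suc n ×′ 1#)     ≈⟨ ⁻¹-∙-comm _ _ ⟨
      - (suc m ×′ 1#) - suc n ×′ 1#     ∎

    pos-*-homo : ∀ m j → ⟦ + m ℤ.* j ⟧ℤ ≈ m ×′ 1# * ⟦ j ⟧ℤ
    pos-*-homo m (+ n)    = begin
      ⟦ + m ℤ.* + n ⟧ℤ       ≡⟨ ≡.cong ⟦_⟧ℤ (ℤ.pos-* m n) ⟨
      (m ℕ.* n) ×′ 1#        ≈⟨ ×1-homo-* m n ⟩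
      m ×′ 1# * n ×′ 1#      ∎
    pos-*-homo m -[1+ n ] = begin
      ⟦ + m ℤ.* ℤ.- (+ suc n) ⟧ℤ     ≡⟨ ≡.cong ⟦_⟧ℤ (ℤ.neg-distribʳ-* (+ m) (+ suc n)) ⟨
      ⟦ ℤ.- (+ m ℤ.* + suc n) ⟧ℤ     ≈⟨ neg-homo (+ m ℤ.* + suc n) ⟩
      - ⟦ + m ℤ.* + suc n ⟧ℤ         ≈⟨ -‿cong (pos-*-homo m (+ suc n)) ⟩
      - (m ×′ 1# * suc n ×′ 1#)      ≈⟨ -‿distribʳ-* _ _ ⟩
      m ×′ 1# * - (suc n ×′ 1#)      ∎

    *-homo : ∀ i j → ⟦ i ℤ.* j ⟧ℤ ≈ ⟦ i ⟧ℤ * ⟦ j ⟧ℤ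
    *-homo (+ m)    j = pos-*-homo m j
    *-homo -[1+ m ] j = begin
      ⟦ ℤ.- (+ suc m) ℤ.* j ⟧ℤ       ≡⟨ ≡.cong ⟦_⟧ℤ (ℤ.neg-distribˡ-* (+ suc m) j) ⟨
      ⟦ ℤ.- (+ suc m ℤ.* j) ⟧ℤ       ≈⟨ neg-homo (+ suc m ℤ.* j) ⟩
      - ⟦ + suc m ℤ.* j ⟧ℤ           ≈⟨ -‿cong (pos-*-homo (suc m) j) ⟩
      - (suc m ×′ 1# * ⟦ j ⟧ℤ)       ≈⟨ -‿distribˡ-* _ _ ⟩
      - (suc m ×′ 1#) * ⟦ j ⟧ℤ       ∎

    morphism : ℤ.+-*-rawRing -Raw-AlmostCommutative⟶ fromCommutativeRing R
    morphism = record
      { ⟦_⟧    = ⟦_⟧ℤ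
      ; +-homo = +-homo
      ; *-homo = *-homo
      ; -‿homo = neg-homo
      ; 0-homo = refl
      ; 1-homo = refl
      }

    _coeff≟_ : ∀ i j → Maybe (⟦ i ⟧ℤ ≈ ⟦ j ⟧ℤ)
    i coeff≟ j with i ℤ.≟ j
    ... | yes i≡j = just (reflexive (≡.cong ⟦_⟧ℤ i≡j))
    ... | no  _   = nothing

  open RingSolver ℤ.+-*-rawRing (fromCommutativeRing R) morphism _coeff≟_ public
    hiding (⟦_⟧)

------------------------------------------------------------------------
-- Finite fields

record FiniteField (c ℓ : Level) : Set (lsuc (c ⊔ ℓ)) where
  field
    commutativeRing : CommutativeRing c ℓ

  open CommutativeRing commutativeRing public

  field
    1≉0         : 1# ≉ 0#
    inverse     : ∀ x → x ≉ 0# → ∃[ y ] x * y ≈ 1#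
    order       : ℕ
    enumeration : Inverse setoid (≡.setoid (Fin order))

  open RawSemiringDefinitions (Semiring.rawSemiring semiring) public
    using (_^_) renaming (_×_ to _·_)

  infix 4 _≟_

  _≟_ : Decidable _≈_
  _≟_ = via-injection (Inverse⇒Injection enumeration) Fin._≟_

  infix  9 _⁻¹
  infixl 7 _/_

  -- Total, with 0# ⁻¹ = 0#.
  _⁻¹ : Carrier → Carrier
  x ⁻¹ with x ≟ 0#
  ... | yes _  = 0#
  ... | no x≉0 = proj₁ (inverse x x≉0)

  _/_ : Carrier → Carrier → Carrier
  x / y = x * y ⁻¹

  PrimitiveRoot : ℕ → Carrier → Set ℓ
  PrimitiveRoot n x = x ^ n ≈ 1# × (∀ m → 0 ℕ.< m → m ℕ.< n → x ^ m ≉ 1#)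

  /-cancel : ∀ x {y} → y ≉ 0# → (x / y) * y ≈ x
  /-cancel x {y} y≉0 with y ≟ 0#
  ... | yes y≈0 = contradiction y≈0 y≉0
  ... | no  y≉0 = trans (*-assoc _ _ _)
                 (trans (*-congˡ (trans (*-comm _ _) (proj₂ (inverse y y≉0))))
                        (*-identityʳ x))

  *-cancelʳ-0 : ∀ {x y} → y ≉ 0# → x * y ≈ 0# → x ≈ 0#
  *-cancelʳ-0 {x} {y} y≉0 xy≈0 with inverse y y≉0
  ... | z , yz≈1 = begin
    x            ≈⟨ *-identityʳ x ⟨
    x * 1#       ≈⟨ *-congˡ yz≈1 ⟨
    x * (y * z)  ≈⟨ *-assoc x y z ⟨
    x * y * z    ≈⟨ *-congʳ xy≈0 ⟩
    0# * z       ≈⟨ zeroˡ z ⟩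
    0#           ∎
    where open SetoidReasoning setoid

------------------------------------------------------------------------
-- Weierstrass curves

module WeierstrassCurves {c ℓ : Level} (F : FiniteField c ℓ) where

  open FiniteField F
  open RingProperties ring using (x≈y⇒x∙y⁻¹≈ε; x∙y⁻¹≈ε⇒x≈y)

  -- y² + a₁xy + a₃y = x³ + a₂x² + a₄x + a₆
  record WeierstrassCurve : Set c where
    constructor weierstrass
    field
      a₁ a₂ a₃ a₄ a₆ : Carrier

    b₂ b₄ b₆ b₈ Δ : Carrier
    b₂ = a₁ ^ 2 + 4 · a₂
    b₄ = 2 · a₄ + a₁ * a₃
    b₆ = a₃ ^ 2 + 4 · a₆
    b₈ = a₁ ^ 2 * a₆ + 4 · (a₂ * a₆) - a₁ * a₃ * a₄ + a₂ * a₃ ^ 2 - a₄ ^ 2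
    Δ  = - (b₂ ^ 2 * b₈) - 8 · (b₄ ^ 3) - 27 · (b₆ ^ 2) + 9 · (b₂ * b₄ * b₆)

    OnCurve : Carrier → Carrier → Set ℓ
    OnCurve x y =
      y ^ 2 + a₁ * x * y + a₃ * y ≈ x ^ 3 + a₂ * x ^ 2 + a₄ * x + a₆

    -- The line of slope l through (x₁ , y₁) meets the curve in points with
    -- x-coordinates x₁, x₂ and thirdX l x₁ x₂, counted with multiplicity.
    thirdX : Carrier → Carrier → Carrier → Carrier
    thirdX l x₁ x₂ = l ^ 2 + a₁ * l - a₂ - x₁ - x₂

    line : Carrier → Carrier → Carrier → Carrier → Carrier
    line l x₁ y₁ x = l * (x - x₁) + y₁

    negY : Carrier → Carrier → Carrier
    negY x y = - y - a₁ * x - a₃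

    chordSlope : Carrier → Carrier → Carrier → Carrier → Carrier
    chordSlope x₁ y₁ x₂ y₂ = (y₂ - y₁) / (x₂ - x₁)

    tangentSlope : Carrier → Carrier → Carrier
    tangentSlope x y =
      (3 · (x ^ 2) + 2 · (a₂ * x) + a₄ - a₁ * y) / (2 · y + a₁ * x + a₃)

  Elliptic : WeierstrassCurve → Set ℓ
  Elliptic W = WeierstrassCurve.Δ W ≉ 0#

  module OnCurveProperties (W : WeierstrassCurve) where

    open WeierstrassCurve W
    open IntegerSolver commutativeRing
    open SetoidReasoning setoid

    private
      f : Carrier → Carrier → Carrier
      f x y = (y ^ 2 + a₁ * x * y + a₃ * y) - (x ^ 3 + a₂ * x ^ 2 + a₄ * x + a₆)

      f-poly : ∀ {n} (a₁ a₂ a₃ a₄ a₆ x y : Polynomial n) → Polynomial n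
      f-poly a₁ a₂ a₃ a₄ a₆ x y =
        (y :^ 2 :+ a₁ :* x :* y :+ a₃ :* y) :-
        (x :^ 3 :+ a₂ :* x :^ 2 :+ a₄ :* x :+ a₆)

      negY-identity : ∀ x y → f x (negY x y) ≈ f x y
      negY-identity x y = solve 7 (λ a₁ a₂ a₃ a₄ a₆ x y →
          f-poly a₁ a₂ a₃ a₄ a₆ x (:- y :- a₁ :* x :- a₃) :=
          f-poly a₁ a₂ a₃ a₄ a₆ x y)
        refl a₁ a₂ a₃ a₄ a₆ x y

      chord-identity : ∀ l x₁ y₁ x₂ → let x₃ = thirdX l x₁ x₂ in
        f x₃ (line l x₁ y₁ x₃) * (x₂ - x₁) ≈
        f x₁ y₁ * (x₂ - x₃) + f x₂ (line l x₁ y₁ x₂) * (x₃ - x₁)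
      chord-identity l x₁ y₁ x₂ = solve 9 (λ y₁ a₆ a₄ a₃ a₂ x₁ x₂ a₁ l →
          let x₃ = l :^ 2 :+ a₁ :* l :- a₂ :- x₁ :- x₂
              y x = l :* (x :- x₁) :+ y₁
              f = f-poly a₁ a₂ a₃ a₄ a₆ in
          f x₃ (y x₃) :* (x₂ :- x₁) :=
          f x₁ y₁ :* (x₂ :- x₃) :+ f x₂ (y x₂) :* (x₃ :- x₁))
        refl y₁ a₆ a₄ a₃ a₂ x₁ x₂ a₁ l

      tangent-identity : ∀ l x₁ y₁ → let x₃ = thirdX l x₁ x₁ in
        f x₃ (line l x₁ y₁ x₃) ≈
        f x₁ y₁ + (x₃ - x₁) *
          (l * (2 · y₁ + a₁ * x₁ + a₃) -
           (3 · (x₁ ^ 2) + 2 · (a₂ * x₁) + a₄ - a₁ * y₁))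
      tangent-identity l x₁ y₁ = solve 8 (λ y₁ a₆ a₄ a₃ a₂ x₁ a₁ l →
          let x₃ = l :^ 2 :+ a₁ :* l :- a₂ :- x₁ :- x₁
              y x = l :* (x :- x₁) :+ y₁
              f = f-poly a₁ a₂ a₃ a₄ a₆ in
          f x₃ (y x₃) :=
          f x₁ y₁ :+ (x₃ :- x₁) :*
            (l :* (2 :× y₁ :+ a₁ :* x₁ :+ a₃) :-
             (3 :× (x₁ :^ 2) :+ 2 :× (a₂ :* x₁) :+ a₄ :- a₁ :* y₁)))
        refl y₁ a₆ a₄ a₃ a₂ x₁ a₁ l

      f-congʳ : ∀ x {y y′} → y ≈ y′ → f x y ≈ f x y′
      f-congʳ x {y} {y′} y≈y′ =
        +-congʳ (+-cong (+-cong (*-cong y≈y′ (*-congʳ y≈y′)) (*-congˡ y≈y′))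
                        (*-congˡ y≈y′))

      f≈0 : ∀ {x y} → OnCurve x y → f x y ≈ 0#
      f≈0 = x≈y⇒x∙y⁻¹≈ε

      f≈0⁻¹ : ∀ {x y} → f x y ≈ 0# → OnCurve x y
      f≈0⁻¹ = x∙y⁻¹≈ε⇒x≈y _ _

    negY-onCurve : ∀ {x y} → OnCurve x y → OnCurve x (negY x y)
    negY-onCurve {x} {y} p = f≈0⁻¹ (trans (negY-identity x y) (f≈0 p))

    chord-onCurve : ∀ {x₁ y₁ x₂ y₂} → OnCurve x₁ y₁ → OnCurve x₂ y₂ → x₁ ≉ x₂ →
      let l = chordSlope x₁ y₁ x₂ y₂; x₃ = thirdX l x₁ x₂ in
      OnCurve x₃ (line l x₁ y₁ x₃)
    chord-onCurve {x₁} {y₁} {x₂} {y₂} p₁ p₂ x₁≉x₂ =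
      f≈0⁻¹ (*-cancelʳ-0 x₂-x₁≉0 (begin
        f x₃ (line l x₁ y₁ x₃) * (x₂ - x₁)
          ≈⟨ chord-identity l x₁ y₁ x₂ ⟩
        f x₁ y₁ * (x₂ - x₃) + f x₂ (line l x₁ y₁ x₂) * (x₃ - x₁)
          ≈⟨ +-cong (*-congʳ (f≈0 p₁))
                    (*-congʳ (trans (f-congʳ x₂ through-y₂) (f≈0 p₂))) ⟩
        0# * (x₂ - x₃) + 0# * (x₃ - x₁)
          ≈⟨ +-cong (zeroˡ _) (zeroˡ _) ⟩
        0# + 0#
          ≈⟨ +-identityˡ 0# ⟩
        0# ∎))
      where
      l x₃ : Carrier
      l  = chordSlope x₁ y₁ x₂ y₂
      x₃ = thirdX l x₁ x₂

      x₂-x₁≉0 : x₂ - x₁ ≉ 0#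
      x₂-x₁≉0 eq = x₁≉x₂ (sym (x∙y⁻¹≈ε⇒x≈y x₂ x₁ eq))

      through-y₂ : line l x₁ y₁ x₂ ≈ y₂
      through-y₂ = trans (+-congʳ (/-cancel (y₂ - y₁) x₂-x₁≉0))
        (solve 2 (λ y₁ y₂ → y₂ :- y₁ :+ y₁ := y₂) refl y₁ y₂)

    tangent-onCurve : ∀ {x₁ y₁} → OnCurve x₁ y₁ → 2 · y₁ + a₁ * x₁ + a₃ ≉ 0# →
      let l = tangentSlope x₁ y₁; x₃ = thirdX l x₁ x₁ in
      OnCurve x₃ (line l x₁ y₁ x₃)
    tangent-onCurve {x₁} {y₁} p d≉0 = f≈0⁻¹ (begin
      f x₃ (line l x₁ y₁ x₃)          ≈⟨ tangent-identity l x₁ y₁ ⟩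
      f x₁ y₁ + (x₃ - x₁) * (l * d - n) ≈⟨ +-cong (f≈0 p) (*-congˡ (x≈y⇒x∙y⁻¹≈ε (/-cancel n d≉0))) ⟩
      0# + (x₃ - x₁) * 0#             ≈⟨ +-congˡ (zeroʳ _) ⟩
      0# + 0#                         ≈⟨ +-identityˡ 0# ⟩
      0#                              ∎)
      where
      l x₃ n d : Carrier
      l  = tangentSlope x₁ y₁
      x₃ = thirdX l x₁ x₁
      n  = 3 · (x₁ ^ 2) + 2 · (a₂ * x₁) + a₄ - a₁ * y₁
      d  = 2 · y₁ + a₁ * x₁ + a₃

    negY-cong : ∀ {x y x′ y′} → x ≈ x′ → y ≈ y′ → negY x y ≈ negY x′ y′
    negY-cong x≈x′ y≈y′ =
      +-congʳ (+-cong (-‿cong y≈y′) (-‿cong (*-congˡ x≈x′)))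

    onCurve-congˡ : ∀ {x x′ y} → x ≈ x′ → OnCurve x y → OnCurve x′ y
    onCurve-congˡ {x} {x′} {y} x≈x′ p = begin
      y ^ 2 + a₁ * x′ * y + a₃ * y         ≈⟨ +-congʳ (+-congˡ (*-congʳ (*-congˡ x≈x′))) ⟨
      y ^ 2 + a₁ * x * y + a₃ * y          ≈⟨ p ⟩
      x ^ 3 + a₂ * x ^ 2 + a₄ * x + a₆     ≈⟨ +-congʳ (+-cong (+-cong x³ (*-congˡ x²)) (*-congˡ x≈x′)) ⟩
      x′ ^ 3 + a₂ * x′ ^ 2 + a₄ * x′ + a₆  ∎
      where
      x² : x ^ 2 ≈ x′ ^ 2
      x² = *-cong x≈x′ (*-congʳ x≈x′)
      x³ : x ^ 3 ≈ x′ ^ 3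
      x³ = *-cong x≈x′ x²

    -- A point that is not the opposite of another one with the same
    -- x-coordinate is equal to it, and is not its own opposite.
    tangent-denominator≉0 : ∀ {x₁ y₁ x₂ y₂} →
      OnCurve x₁ y₁ → OnCurve x₂ y₂ → x₁ ≈ x₂ → y₁ ≉ negY x₂ y₂ →
      2 · y₁ + a₁ * x₁ + a₃ ≉ 0#
    tangent-denominator≉0 {x₁} {y₁} {x₂} {y₂} p₁ p₂ x₁≈x₂ y₁≉-y₂ d≈0 =
      y₁≉-y₂ (trans y₁≈-y₁ (negY-cong x₁≈x₂ y₁≈y₂))
      where
      y₁≈-y₁ : y₁ ≈ negY x₁ y₁
      y₁≈-y₁ = x∙y⁻¹≈ε⇒x≈y _ _ (trans
        (solve 4 (λ a₁ a₃ x y →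
            y :- (:- y :- a₁ :* x :- a₃) := 2 :× y :+ a₁ :* x :+ a₃)
          refl a₁ a₃ x₁ y₁)
        d≈0)

      y₁≈y₂ : y₁ ≈ y₂
      y₁≈y₂ = x∙y⁻¹≈ε⇒x≈y _ _ (*-cancelʳ-0
        (λ eq → y₁≉-y₂ (trans (x∙y⁻¹≈ε⇒x≈y _ _ eq) (negY-cong x₁≈x₂ refl)))
        (begin
          (y₁ - y₂) * (y₁ - negY x₁ y₂)
            ≈⟨ solve 8 (λ a₁ a₂ a₃ a₄ a₆ x y₁ y₂ →
                 let f = f-poly a₁ a₂ a₃ a₄ a₆ in
                 (y₁ :- y₂) :* (y₁ :- (:- y₂ :- a₁ :* x :- a₃)) :=
                 f x y₁ :- f x y₂)
               refl a₁ a₂ a₃ a₄ a₆ x₁ y₁ y₂ ⟩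
          f x₁ y₁ - f x₁ y₂
            ≈⟨ x≈y⇒x∙y⁻¹≈ε (trans (f≈0 p₁)
                 (sym (f≈0 (onCurve-congˡ (sym x₁≈x₂) p₂)))) ⟩
          0# ∎))

  module _ (W : WeierstrassCurve) where

    open WeierstrassCurve W
    open OnCurveProperties W

    data Point : Set (c ⊔ ℓ) where
      ∞      : Point
      affine : (x y : Carrier) → OnCurve x y → Point

    infix 4 _≈ₚ_

    data _≈ₚ_ : Point → Point → Set (c ⊔ ℓ) where
      ∞≈∞    : ∞ ≈ₚ ∞
      affine : ∀ {x y p x′ y′ p′} → x ≈ x′ → y ≈ y′ →
               affine x y p ≈ₚ affine x′ y′ p′

    negate : Point → Point
    negate ∞              = ∞
    negate (affine x y p) = affine x (negY x y) (negY-onCurve p)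

    infixl 6 _⊕_

    _⊕_ : Point → Point → Point
    ∞              ⊕ Q = Q
    affine x y p   ⊕ ∞ = affine x y p
    affine x₁ y₁ p₁ ⊕ affine x₂ y₂ p₂ with x₁ ≟ x₂ | y₁ ≟ negY x₂ y₂
    ... | no x₁≉x₂  | _         = negate (affine _ _ (chord-onCurve p₁ p₂ x₁≉x₂))
    ... | yes _     | yes _     = ∞
    ... | yes x₁≈x₂ | no y₁≉-y₂ = negate (affine _ _
          (tangent-onCurve p₁ (tangent-denominator≉0 p₁ p₂ x₁≈x₂ y₁≉-y₂)))

    -- The chord–tangent law; when Δ ≉ 0# these are the operations of the
    -- group of rational points of the elliptic curve.
    pointGroup : RawGroup (c ⊔ ℓ) (c ⊔ ℓ)
    pointGroup = record
      { Carrier = Point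
      ; _≈_     = _≈ₚ_
      ; _∙_     = _⊕_
      ; ε       = ∞
      ; _⁻¹     = negate
      }

  NonCyclicTorsion : ℕ → WeierstrassCurve → Set (c ⊔ ℓ)
  NonCyclicTorsion n W = ¬ Cyclic (Torsion n)
    where open GroupTheory (pointGroup W)

  -- Isomorphism over the base field, as an admissible change of variables
  --   x = u²x′ + r,  y = u³y′ + u²sx′ + t
  -- transforming the equation of W into u⁶ times that of W′.
  infix 4 _≅_

  record _≅_ (W W′ : WeierstrassCurve) : Set (c ⊔ ℓ) where
    private
      module W  = WeierstrassCurve W
      module W′ = WeierstrassCurve W′
    field
      u r s t : Carrier
      u≉0     : u ≉ 0#
      a₁-eq   : u * W′.a₁ ≈ W.a₁ + 2 · s
      a₂-eq   : u ^ 2 * W′.a₂ ≈ W.a₂ - s * W.a₁ + 3 · r - s ^ 2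
      a₃-eq   : u ^ 3 * W′.a₃ ≈ W.a₃ + r * W.a₁ + 2 · t
      a₄-eq   : u ^ 4 * W′.a₄ ≈
                W.a₄ - s * W.a₃ + 2 · (r * W.a₂) - (t + r * s) * W.a₁
                + 3 · (r ^ 2) - 2 · (s * t)
      a₆-eq   : u ^ 6 * W′.a₆ ≈
                W.a₆ + r * W.a₄ + r ^ 2 * W.a₂ + r ^ 3
                - t * W.a₃ - t ^ 2 - r * t * W.a₁

  -- Parameters a with a (a - (ρ+1)/3) (a - ρ/3) ≠ 0; here 3 means 3 · 1#.
  Admissible : Carrier → Carrier → Set ℓ
  Admissible ρ a =
    a * (a - (ρ + 1#) / (3 · 1#)) * (a - ρ / (3 · 1#)) ≉ 0#

  -- y² + (3a - 1)xy + a(ρ - 1)(a - (ρ+1)/3)y = x³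
  family : Carrier → Carrier → WeierstrassCurve
  family ρ a = weierstrass
    (3 · a - 1#)
    0#
    (a * (ρ - 1#) * (a - (ρ + 1#) / (3 · 1#)))
    0#
    0#

{-# OPTIONS --safe #-}
module Submission where

-- A point of order 3 is a flex: its tangent meets the curve there three times.
-- Moving a flex with tangent slope l to the origin, tangent to the x-axis, gives
-- y² + bxy + dy = x³.  If x ≠ 0 is the abscissa of a second flex and z = d / x,
-- then b² + 3bz + 3z² + 3x = 0, so that b³ - 27d = (b + 3z)³ is a cube.  On E_a
-- that cube is (3a - ρ)³, which leads to the scaling u(ρ - 1) = -3z, that is
-- u = (ρ + 2)z, and to a = (b + u)/3u.  Flexes can be searched for exhaustively,
-- so a curve without two flexes of distinct abscissae has cyclic 3-torsion.

open import Defs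
import Algebra.Properties.Monoid.Mult as MonoidMult
import Algebra.Properties.Ring as RingProperties
import Algebra.Properties.Semiring.Exp as SemiringExp
open import Data.Fin.Properties using (any?)
open import Data.Integer.Base using (+_; -[1+_])
open import Data.Nat.Base using (nonZero; ℕ; zero; suc; z<s; s<s)
open import Data.Nat.DivMod using (_%_)
open import Data.Product.Base using (∃-syntax; _×_; _,_; proj₁; proj₂)
open import Data.Sum.Base using (_⊎_; inj₁; inj₂)
open import Data.Unit.Base using (⊤)
open import Function.Base using (_∘_)
open import Function.Bundles using (Inverse)
open import Level using (Level; Lift; _⊔_)
open import Relation.Binary.PropositionalEquality as ≡ using (_≡_)
open import Relation.Nullary using (¬_; Dec; yes; no; contradiction)
open import Relation.Nullary.Decidable using (_×-dec_; ¬?; map′)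

-- Arithmetic, exhaustive search and solver terms over a finite field.

module FieldProperties {c ℓ : Level} (F : FiniteField c ℓ) where

  open FiniteField F
  open IntegerSolver commutativeRing
  open RingProperties ring using (x≈y⇒x∙y⁻¹≈ε; x∙y⁻¹≈ε⇒x≈y)

  ·-congʳ : ∀ n {x y} → x ≈ y → n · x ≈ n · y
  ·-congʳ = MonoidMult.×-congʳ +-monoid

  ^-congˡ : ∀ n {x y} → x ≈ y → x ^ n ≈ y ^ n
  ^-congˡ = SemiringExp.^-congˡ semiring

  -‿cong₂ : ∀ {x x′ y y′} → x ≈ x′ → y ≈ y′ → x - y ≈ x′ - y′
  -‿cong₂ x≈x′ y≈y′ = +-cong x≈x′ (-‿cong y≈y′)

  -- Nested applications prove an identity modulo several relations A ≈ B, the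
  -- k being the cofactors.
  modulo : ∀ {x y k A B} → A ≈ B → x ≈ y + k * (A - B) → x ≈ y
  modulo A≈B eq = trans eq
    (trans (+-congˡ (trans (*-congˡ (x≈y⇒x∙y⁻¹≈ε A≈B)) (zeroʳ _))) (+-identityʳ _))

  *-≉0 : ∀ {x y} → x ≉ 0# → y ≉ 0# → x * y ≉ 0#
  *-≉0 x≉0 y≉0 = x≉0 ∘ *-cancelʳ-0 y≉0

  *-≉0⁻ˡ : ∀ {x y} → x * y ≉ 0# → x ≉ 0#
  *-≉0⁻ˡ xy≉0 x≈0 = xy≉0 (trans (*-congʳ x≈0) (zeroˡ _))

  *-≉0⁻ʳ : ∀ {x y} → x * y ≉ 0# → y ≉ 0#
  *-≉0⁻ʳ xy≉0 y≈0 = xy≉0 (trans (*-congˡ y≈0) (zeroʳ _))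

  -≉0 : ∀ {x y} → x ≉ y → x - y ≉ 0#
  -≉0 x≉y = x≉y ∘ x∙y⁻¹≈ε⇒x≈y _ _

  *-cancelʳ : ∀ {x y z} → z ≉ 0# → x * z ≈ y * z → x ≈ y
  *-cancelʳ {x} {y} {z} z≉0 eq = x∙y⁻¹≈ε⇒x≈y _ _ (*-cancelʳ-0 z≉0
    (trans (solve 3 (λ x y z → (x :- y) :* z := x :* z :- y :* z) refl x y z)
           (x≈y⇒x∙y⁻¹≈ε eq)))

  /-unique : ∀ {x y z} → y ≉ 0# → z * y ≈ x → x / y ≈ z
  /-unique y≉0 zy≈x = *-cancelʳ y≉0 (trans (/-cancel _ y≉0) (sym zy≈x))

  ^-≉0 : ∀ n {x} → x ≉ 0# → x ^ n ≉ 0#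
  ^-≉0 zero    x≉0 = 1≉0
  ^-≉0 (suc n) x≉0 = *-≉0 x≉0 (^-≉0 n x≉0)

  -- Only the representatives `from i` of the enumeration are tested, so `P` has to respect `≈` for
  -- a witness to be carried to its representative.
  search : ∀ {p} {P : Carrier → Set p} → (∀ x → Dec (P x)) →
           (∀ {x y} → x ≈ y → P x → P y) → Dec (∃[ x ] P x)
  search P? resp = map′ (λ (i , p) → from i , p)
    (λ (x , p) → to x , resp (sym (strictlyInverseʳ x)) p) (any? (P? ∘ from))
    where open Inverse enumeration

  -- Solver terms mirroring the expressions of a Weierstrass curve. The coefficients are arguments,
  -- so that the same terms serve the given curve, its translate and the family.
  module CurvePolynomials {n} (a₁ a₂ a₃ a₄ a₆ : Polynomial n) where

    curveˡ curveʳ numerᵖ denomᵖ tripleᵖ : Polynomial n → Polynomial n → Polynomial n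
    curveˡ x y  = y :^ 2 :+ a₁ :* x :* y :+ a₃ :* y
    curveʳ x y  = x :^ 3 :+ a₂ :* x :^ 2 :+ a₄ :* x :+ a₆
    numerᵖ x y  = 3 :× (x :^ 2) :+ 2 :× (a₂ :* x) :+ a₄ :- a₁ :* y
    denomᵖ x y  = 2 :× y :+ a₁ :* x :+ a₃
    tripleᵖ l x = l :^ 2 :+ a₁ :* l :- a₂ :- x :- x

    b₂ᵖ b₄ᵖ b₆ᵖ b₈ᵖ : Polynomial n
    b₂ᵖ = a₁ :^ 2 :+ 4 :× a₂
    b₄ᵖ = 2 :× a₄ :+ a₁ :* a₃
    b₆ᵖ = a₃ :^ 2 :+ 4 :× a₆
    b₈ᵖ = a₁ :^ 2 :* a₆ :+ 4 :× (a₂ :* a₆) :- a₁ :* a₃ :* a₄ :+ a₂ :* a₃ :^ 2 :- a₄ :^ 2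

-- Flexes as the points of order three.

module Flexes {c ℓ : Level} (F : FiniteField c ℓ)
              (W : WeierstrassCurves.WeierstrassCurve F) where

  open FiniteField F
  open FieldProperties F
  open WeierstrassCurves F
  open WeierstrassCurve W
  open OnCurveProperties W
  open GroupTheory (pointGroup W) using (Torsion; Cyclic; _·ᶻ_) renaming (_·_ to _·ₚ_)
  open IntegerSolver commutativeRing
  open RingProperties ring using (x≈y⇒x∙y⁻¹≈ε; x∙y⁻¹≈ε⇒x≈y)

  numer denom : Carrier → Carrier → Carrier
  numer x y = 3 · (x ^ 2) + 2 · (a₂ * x) + a₄ - a₁ * y
  denom x y = 2 · y + a₁ * x + a₃

  -- The tangent at (x , y) has slope l and meets the curve there three times.
  record Flex (x y l : Carrier) : Set ℓ where
    field
      onCurve : OnCurve x y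
      denom≉0 : denom x y ≉ 0#
      tangent : l * denom x y ≈ numer x y
      triple  : thirdX l x x ≈ x

  onCurve? : ∀ x y → Dec (OnCurve x y)
  onCurve? x y = _ ≟ _

  flex? : ∀ x y l → Dec (Flex x y l)
  flex? x y l = map′
    (λ (p , d , t , i) → record { onCurve = p ; denom≉0 = d ; tangent = t ; triple = i })
    (λ f → let open Flex f in onCurve , denom≉0 , tangent , triple)
    (onCurve? x y ×-dec ¬? (_ ≟ _) ×-dec (_ ≟ _) ×-dec (_ ≟ _))

  module _ {x x′ y y′} (x≈x′ : x ≈ x′) (y≈y′ : y ≈ y′) where

    onCurve-cong : OnCurve x y → OnCurve x′ y′
    onCurve-cong p = trans
      (+-cong (+-cong (^-congˡ 2 (sym y≈y′)) (*-cong (*-congˡ (sym x≈x′)) (sym y≈y′)))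
              (*-congˡ (sym y≈y′)))
      (trans p
        (+-congʳ (+-cong (+-cong (^-congˡ 3 x≈x′) (*-congˡ (^-congˡ 2 x≈x′))) (*-congˡ x≈x′))))

    denom-cong : denom x y ≈ denom x′ y′
    denom-cong = +-congʳ (+-cong (·-congʳ 2 y≈y′) (*-congˡ x≈x′))

    numer-cong : numer x y ≈ numer x′ y′
    numer-cong = -‿cong₂
      (+-congʳ (+-cong (·-congʳ 3 (^-congˡ 2 x≈x′)) (·-congʳ 2 (*-congˡ x≈x′))))
      (*-congˡ y≈y′)

    flex-cong : ∀ {l l′} → l ≈ l′ → Flex x y l → Flex x′ y′ l′
    flex-cong {l} {l′} l≈l′ f = record
      { onCurve = onCurve-cong onCurve
      ; denom≉0 = denom≉0 ∘ trans denom-cong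
      ; tangent = trans (sym (*-cong l≈l′ denom-cong)) (trans tangent numer-cong)
      ; triple  = trans (sym (thirdX-cong l≈l′ x≈x′)) (trans triple x≈x′)
      }
      where
      open Flex f
      thirdX-cong : ∀ {l l′ x x′} → l ≈ l′ → x ≈ x′ → thirdX l x x ≈ thirdX l′ x′ x′
      thirdX-cong l≈l′ x≈x′ = -‿cong₂
        (-‿cong₂ (+-congʳ (+-cong (^-congˡ 2 l≈l′) (*-congˡ l≈l′))) x≈x′) x≈x′

  searchFlex : ∀ {p} {P : Carrier → Set p} → (∀ x → Dec (P x)) →
    (∀ {x y} → x ≈ y → P x → P y) → Dec (∃[ x ] ∃[ y ] ∃[ l ] (P x × Flex x y l))
  searchFlex P? resp =
    search (λ x → search (λ y → search (λ l → P? x ×-dec flex? x y l)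
      (λ l≈ (p , f) → p , flex-cong refl refl l≈ f))
      (λ y≈ (l , p , f) → l , p , flex-cong refl y≈ refl f))
      (λ x≈ (y , l , p , f) → y , l , resp x≈ p , flex-cong x≈ refl refl f)

  negY-involutive : ∀ x y → negY x (negY x y) ≈ y
  negY-involutive x y = solve 4 (λ a₁ a₃ x y →
    :- (:- y :- a₁ :* x :- a₃) :- a₁ :* x :- a₃ := y) refl a₁ a₃ x y

  ⊕-∞⇒x≈ : ∀ {x₁ y₁ x₂ y₂ p₁ p₂} →
    _⊕_ W (affine x₁ y₁ p₁) (affine x₂ y₂ p₂) ≡ ∞ → x₁ ≈ x₂
  ⊕-∞⇒x≈ {x₁} {y₁} {x₂} {y₂} eq with x₁ ≟ x₂ | y₁ ≟ negY x₂ y₂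
  ... | yes x₁≈x₂ | yes _ = x₁≈x₂
  ⊕-∞⇒x≈ () | yes _ | no _
  ⊕-∞⇒x≈ () | no _ | _

  ⊕-negate : ∀ {x₁ y₁ x₂ y₂ p₁ p₂} → x₁ ≈ x₂ → y₁ ≈ negY x₂ y₂ →
    _⊕_ W (affine x₁ y₁ p₁) (affine x₂ y₂ p₂) ≡ ∞
  ⊕-negate {x₁} {y₁} {x₂} {y₂} x≈ y≈ with x₁ ≟ x₂ | y₁ ≟ negY x₂ y₂
  ... | yes _ | yes _ = ≡.refl
  ... | no x≉ | _     = contradiction x≈ x≉
  ... | yes _ | no y≉ = contradiction y≈ y≉

  -- A view of P ⊕ P. Abstracting over the sum in a `with` forgets how it was computed, and the
  -- constructors bring that back; `generic` accepts any proof `q` that the point lies on the curve.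
  data Double (x y : Carrier) : Point W → Set (c ⊔ ℓ) where
    order-two : denom x y ≈ 0# → Double x y ∞
    generic   : denom x y ≉ 0# → let l = tangentSlope x y; x₃ = thirdX l x x in
                ∀ q → Double x y (affine x₃ (negY x₃ (line l x y x₃)) q)

  double : ∀ x y p → Double x y (_⊕_ W (affine x y p) (affine x y p))
  double x y p with x ≟ x | y ≟ negY x y
  ... | no x≉x  | _      = contradiction refl x≉x
  ... | yes x≈x | no y≉  = generic (tangent-denominator≉0 p p x≈x y≉) _
  ... | yes _   | yes y≈ = order-two (trans
    (solve 4 (λ a₁ a₃ x y →
       2 :× y :+ a₁ :* x :+ a₃ := y :- (:- y :- a₁ :* x :- a₃)) refl a₁ a₃ x y)
    (x≈y⇒x∙y⁻¹≈ε y≈))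

  ≈∞⇒≡∞ : ∀ {P} → _≈ₚ_ W P ∞ → P ≡ ∞
  ≈∞⇒≡∞ ∞≈∞ = ≡.refl

  ≡∞⇒≈∞ : ∀ {P} → P ≡ ∞ → _≈ₚ_ W P ∞
  ≡∞⇒≈∞ ≡.refl = ∞≈∞

  -- `3 ·ₚ P` unfolds to P ⊕ (P ⊕ P). This is `∞` only if P ⊕ P is affine with the abscissa of P,
  -- which means that the third intersection of the tangent is again at `x`.
  torsion⇒flex : ∀ {x y p} → Torsion 3 (affine x y p) → Flex x y (tangentSlope x y)
  torsion⇒flex {x} {y} {p} t
    with _⊕_ W (affine x y p) (affine x y p) | double x y p | ≈∞⇒≡∞ t
  ... | _ | order-two _   | ()
  ... | _ | generic d≉0 q | eq = record
    { onCurve = p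
    ; denom≉0 = d≉0
    ; tangent = /-cancel _ d≉0
    ; triple  = sym (⊕-∞⇒x≈ eq)
    }

  flexPoint : ∀ {x y l} → Flex x y l → Point W
  flexPoint {x} {y} f = affine x y (Flex.onCurve f)

  -- Triple contact puts the third intersection of the tangent at `x`, where the tangent has
  -- ordinate `y`; hence P ⊕ P is the opposite of P.
  flex⇒torsion : ∀ {x y l} (f : Flex x y l) → Torsion 3 (flexPoint f)
  flex⇒torsion {x} {y} {l} f = ≡∞⇒≈∞ tripled
    where
    open Flex f
    P = affine x y onCurve
    slope≈l : tangentSlope x y ≈ l
    slope≈l = /-unique denom≉0 tangent
    x₃ = thirdX (tangentSlope x y) x x
    x₃≈x : x₃ ≈ x
    x₃≈x = trans (+-congʳ (+-congʳ (+-congʳ (+-cong (^-congˡ 2 slope≈l) (*-congˡ slope≈l)))))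
             triple
    through : line (tangentSlope x y) x y x₃ ≈ y
    through = trans (+-congʳ (trans (*-congˡ (x≈y⇒x∙y⁻¹≈ε x₃≈x)) (zeroʳ _))) (+-identityˡ y)
    tripled : _⊕_ W P (_⊕_ W P P) ≡ ∞
    tripled with _⊕_ W P P | double x y onCurve
    ... | _ | order-two d≈0 = contradiction d≈0 denom≉0
    ... | _ | generic _ q =
      ⊕-negate (sym x₃≈x) (sym (trans (negY-involutive _ _) through))

  -- Multiples of a 3-torsion point, and cyclicity.

  multiples : ∀ P → Torsion 3 P → ∀ n →
    n ·ₚ P ≡ ∞ ⊎ n ·ₚ P ≡ P ⊎ n ·ₚ P ≡ _⊕_ W P P
  multiples P t zero = inj₁ ≡.refl
  multiples ∞ t (suc n) with n ·ₚ ∞ | multiples ∞ t n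
  ... | _ | inj₁ ≡.refl        = inj₁ ≡.refl
  ... | _ | inj₂ (inj₁ ≡.refl) = inj₁ ≡.refl
  ... | _ | inj₂ (inj₂ ≡.refl) = inj₁ ≡.refl
  -- Adding P on the left takes `∞` to P, P to P ⊕ P and, by 3-torsion, P ⊕ P back to `∞`.
  multiples P@(affine _ _ _) t (suc n) with n ·ₚ P | multiples P t n
  ... | _ | inj₁ ≡.refl        = inj₂ (inj₁ ≡.refl)
  ... | _ | inj₂ (inj₁ ≡.refl) = inj₂ (inj₂ ≡.refl)
  ... | _ | inj₂ (inj₂ ≡.refl) = inj₁ (≈∞⇒≡∞ t)

  -- `∞` is included, so that all integer multiples of a 3-torsion point satisfy the predicate for
  -- the abscissa of that point.
  HasX : Carrier → Point W → Set ℓ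
  HasX x ∞              = Lift ℓ ⊤
  HasX x (affine x′ _ _) = x′ ≈ x

  negate-hasX : ∀ {x} P → HasX x P → HasX x (negate W P)
  negate-hasX ∞              h = h
  negate-hasX (affine _ _ _) h = h

  multiples-hasX : ∀ {x y p} → Torsion 3 (affine x y p) → ∀ k → HasX x (k ·ᶻ affine x y p)
  multiples-hasX {x} {y} {p} t = integer
    where
    P = affine x y p
    2P-hasX : HasX x (_⊕_ W P P)
    2P-hasX with _⊕_ W P P | ≈∞⇒≡∞ t
    ... | ∞            | _  = _
    ... | affine _ _ _ | eq = sym (⊕-∞⇒x≈ eq)
    natural : ∀ n → HasX x (n ·ₚ P)
    natural n with n ·ₚ P | multiples P t n
    ... | _ | inj₁ ≡.refl        = _
    ... | _ | inj₂ (inj₁ ≡.refl) = refl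
    ... | _ | inj₂ (inj₂ ≡.refl) = 2P-hasX
    integer : ∀ k → HasX x (k ·ᶻ P)
    integer (+ n)    = natural n
    integer -[1+ n ] = negate-hasX (suc n ·ₚ P) (natural (suc n))

  multiples-∞ : ∀ k → k ·ᶻ ∞ ≡ ∞
  multiples-∞ (+ n)    = natural n
    where
    natural : ∀ n → n ·ₚ ∞ ≡ ∞
    natural zero    = ≡.refl
    natural (suc n) = natural n
  multiples-∞ -[1+ n ] = ≡.cong (negate W) (multiples-∞ (+ suc n))

  hasX-resp : ∀ {x P Q} → _≈ₚ_ W P Q → HasX x Q → HasX x P
  hasX-resp ∞≈∞            h = h
  hasX-resp (affine x≈ y≈) h = trans x≈ h

  -- The generator `∞` has no affine multiples, and the affine multiples of an affine 3-torsion
  -- generator share its abscissa. Flexes, being 3-torsion, are such multiples.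
  cyclic⇒x≈ : Cyclic (Torsion 3) → ∀ {x₁ y₁ l₁ x₂ y₂ l₂} →
    Flex x₁ y₁ l₁ → Flex x₂ y₂ l₂ → x₁ ≈ x₂
  cyclic⇒x≈ (∞ , _ , generates) f₁ _
    with generates (flexPoint f₁) (flex⇒torsion f₁)
  ... | k , P≈k∞ with () ← ≡.subst (_≈ₚ_ W (flexPoint f₁)) (multiples-∞ k) P≈k∞
  cyclic⇒x≈ (affine x _ _ , t , generates) f₁ f₂ = trans (x≈ f₁) (sym (x≈ f₂))
    where
    x≈ : ∀ {x′ y′ l′} → Flex x′ y′ l′ → x′ ≈ x
    x≈ f with generates (flexPoint f) (flex⇒torsion f)
    ... | k , P≈kG = hasX-resp P≈kG (multiples-hasX t k)

  -- For a common abscissa the two equations differ by (y - y′)(y - `negY x y′`), so one of the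
  -- factors vanishes.
  ≈-or-opposite : ∀ {x y x′ y′} → OnCurve x y → OnCurve x′ y′ → x ≈ x′ →
    y ≈ y′ ⊎ y ≈ negY x′ y′
  ≈-or-opposite {x} {y} {x′} {y′} p p′ x≈x′ with y ≟ y′
  ... | yes y≈y′ = inj₁ y≈y′
  ... | no y≉y′ = inj₂ (trans (x∙y⁻¹≈ε⇒x≈y _ _ (*-cancelʳ-0 (-≉0 y≉y′)
      (modulo p (modulo (sym (onCurve-cong (sym x≈x′) refl p′)) identity))))
    (negY-cong x≈x′ refl))
    where
    identity : (y - negY x y′) * (y - y′) ≈ 0#
      + 1# * ((y ^ 2 + a₁ * x * y + a₃ * y) - (x ^ 3 + a₂ * x ^ 2 + a₄ * x + a₆))
      + 1# * ((x ^ 3 + a₂ * x ^ 2 + a₄ * x + a₆) - (y′ ^ 2 + a₁ * x * y′ + a₃ * y′))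
    identity = solve 8 (λ a₁ a₂ a₃ a₄ a₆ x y y′ →
      let g = x :^ 3 :+ a₂ :* x :^ 2 :+ a₄ :* x :+ a₆ in
      (y :- (:- y′ :- a₁ :* x :- a₃)) :* (y :- y′) := con (+ 0)
      :+ con (+ 1) :* ((y :^ 2 :+ a₁ :* x :* y :+ a₃ :* y) :- g)
      :+ con (+ 1) :* (g :- (y′ :^ 2 :+ a₁ :* x :* y′ :+ a₃ :* y′)))
      refl a₁ a₂ a₃ a₄ a₆ x y y′

  -- The hypothesis is a negation, and exhaustive search turns it into witnesses. Without flexes `∞`
  -- would generate the 3-torsion; if all flexes had the abscissa of the first, that flex would
  -- generate it.
  noncyclic⇒flexes : NonCyclicTorsion 3 W →
    ∃[ x₁ ] ∃[ y₁ ] ∃[ l₁ ] ∃[ x₂ ] ∃[ y₂ ] ∃[ l₂ ]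
      (Flex x₁ y₁ l₁ × x₂ ≉ x₁ × Flex x₂ y₂ l₂)
  noncyclic⇒flexes noncyclic with searchFlex {P = λ _ → ⊤} (λ _ → yes _) (λ _ _ → _)
  ... | no none = contradiction (∞ , ∞≈∞ , trivial) noncyclic
    where
    trivial : ∀ P → Torsion 3 P → ∃[ k ] _≈ₚ_ W P (k ·ᶻ ∞)
    trivial ∞              _ = + 0 , ∞≈∞
    trivial (affine _ _ _) t = contradiction (_ , _ , _ , _ , torsion⇒flex t) none
  ... | yes (x₁ , y₁ , l₁ , _ , f₁)
    with searchFlex {P = _≉ x₁} (λ x → ¬? (x ≟ x₁)) (λ x≈y x≉ → x≉ ∘ trans x≈y)
  ... | yes (x₂ , y₂ , l₂ , x₂≉x₁ , f₂) = x₁ , y₁ , l₁ , x₂ , y₂ , l₂ , f₁ , x₂≉x₁ , f₂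
  ... | no none = contradiction (P , flex⇒torsion f₁ , generates) noncyclic
    where
    P = flexPoint f₁
    generates : ∀ Q → Torsion 3 Q → ∃[ k ] _≈ₚ_ W Q (k ·ᶻ P)
    generates ∞              _ = + 0 , ∞≈∞
    generates (affine x y p) t with x ≟ x₁
    ... | no x≉x₁ = contradiction (_ , _ , _ , x≉x₁ , torsion⇒flex t) none
    ... | yes x≈x₁ with ≈-or-opposite p (Flex.onCurve f₁) x≈x₁
    ...   | inj₁ y≈y₁  = + 1 , affine x≈x₁ y≈y₁
    -- `-[1+ 0 ]` is the integer -1.
    ...   | inj₂ y≈-y₁ = -[1+ 0 ] , affine x≈x₁ y≈-y₁

  -- The b-invariants and the discriminant at a flex.

  module FlexInvariants {x y l} (f : Flex x y l) where

    open Flex f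

    -- The coefficients of y² + bxy + dy = x³, the equation after the flex is moved to the origin
    -- with its tangent along the x-axis. Its b-invariants are b², bd, d² and 0; the next four
    -- formulas are the translation rules for b₂, b₄, b₆ and b₈, solved for the original invariants.
    b d : Carrier
    b = a₁ + 2 · l
    d = denom x y

    b₂-flex : b₂ ≈ b ^ 2 - 12 · x
    b₂-flex = modulo triple (solve 5 (λ a₁ a₂ a₃ x l →
      let open CurvePolynomials a₁ a₂ a₃ (con (+ 0)) (con (+ 0)) in
      b₂ᵖ := (a₁ :+ 2 :× l) :^ 2 :- 12 :× x :+ con -[1+ 3 ] :* (tripleᵖ l x :- x))
      refl a₁ a₂ a₃ x l)

    b₄-flex : b₄ ≈ b * d - x * b₂ - 6 · (x ^ 2)
    b₄-flex = modulo tangent (solve 7 (λ a₁ a₂ a₃ a₄ x y l →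
      let open CurvePolynomials a₁ a₂ a₃ a₄ (con (+ 0)) in
      b₄ᵖ := (a₁ :+ 2 :× l) :* denomᵖ x y :- x :* b₂ᵖ :- 6 :× (x :^ 2)
        :+ con -[1+ 1 ] :* (l :* denomᵖ x y :- numerᵖ x y))
      refl a₁ a₂ a₃ a₄ x y l)

    b₆-flex : b₆ ≈ d ^ 2 - 2 · (x * b₄) - x ^ 2 * b₂ - 4 · (x ^ 3)
    b₆-flex = modulo onCurve (solve 7 (λ a₁ a₂ a₃ a₄ a₆ x y →
      let open CurvePolynomials a₁ a₂ a₃ a₄ a₆ in
      b₆ᵖ := denomᵖ x y :^ 2 :- 2 :× (x :* b₄ᵖ) :- x :^ 2 :* b₂ᵖ :- 4 :× (x :^ 3)
        :+ con -[1+ 3 ] :* (curveˡ x y :- curveʳ x y))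
      refl a₁ a₂ a₃ a₄ a₆ x y)

    -- This says that `x` is a root of the 3-division polynomial 3x⁴ + b₂x³ + 3b₄x² + 3b₆x + b₈.
    b₈-flex : b₈ ≈ - (3 · (x * b₆)) - 3 · (x ^ 2 * b₄) - x ^ 3 * b₂ - 3 · (x ^ 4)
    b₈-flex = modulo onCurve (modulo tangent (modulo triple
      (solve 8 (λ y a₆ a₄ a₃ a₂ a₁ x l →
      let open CurvePolynomials a₁ a₂ a₃ a₄ a₆ in
      b₈ᵖ := :- (3 :× (x :* b₆ᵖ)) :- 3 :× (x :^ 2 :* b₄ᵖ) :- x :^ 3 :* b₂ᵖ :- 3 :× (x :^ 4)
        -- The cofactors come from b₈ = b₂a₆ - a₁a₃a₄ + a₂a₃² - a₄² for the translated curve, whose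
        -- a₆, a₄ and a₂ are the negatives of the three differences.
        :+ (:- (b₂ᵖ :+ 12 :× x)) :* (curveˡ x y :- curveʳ x y)
        :+ (l :* denomᵖ x y :+ numerᵖ x y :+ a₁ :* denomᵖ x y)
             :* (l :* denomᵖ x y :- numerᵖ x y)
        :+ (:- (denomᵖ x y :^ 2)) :* (tripleᵖ l x :- x))
      refl y a₆ a₄ a₃ a₂ a₁ x l)))

    private
      β₂ β₄ β₆ β₈ : Carrier
      β₂ = b ^ 2 - 12 · x
      β₄ = b * d - x * β₂ - 6 · (x ^ 2)
      β₆ = d ^ 2 - 2 · (x * β₄) - x ^ 2 * β₂ - 4 · (x ^ 3)
      β₈ = - (3 · (x * β₆)) - 3 · (x ^ 2 * β₄) - x ^ 3 * β₂ - 3 · (x ^ 4)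

      b₄≈β₄ : b₄ ≈ β₄
      b₄≈β₄ = trans b₄-flex (+-congʳ (-‿cong₂ refl (*-congˡ b₂-flex)))

      b₆≈β₆ : b₆ ≈ β₆
      b₆≈β₆ = trans b₆-flex (+-congʳ (-‿cong₂
        (-‿cong₂ refl (·-congʳ 2 (*-congˡ b₄≈β₄))) (*-congˡ b₂-flex)))

      b₈≈β₈ : b₈ ≈ β₈
      b₈≈β₈ = trans b₈-flex (+-congʳ (-‿cong₂
        (-‿cong₂ (-‿cong (·-congʳ 3 (*-congˡ b₆≈β₆))) (·-congʳ 3 (*-congˡ b₄≈β₄)))
        (*-congˡ b₂-flex)))

    -- Translation preserves the discriminant, and the right side is that of y² + bxy + dy = x³. The
    -- `β`s involve only `b`, `d` and `x`, and `x` cancels.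
    Δ-flex : Δ ≈ d ^ 3 * (b ^ 3 - 27 · d)
    Δ-flex = trans
      (+-cong (-‿cong₂ (-‿cong₂ (-‿cong (*-cong (^-congˡ 2 b₂-flex) b₈≈β₈))
                                (·-congʳ 8 (^-congˡ 3 b₄≈β₄)))
                       (·-congʳ 27 (^-congˡ 2 b₆≈β₆)))
              (·-congʳ 9 (*-cong (*-cong b₂-flex b₄≈β₄) b₆≈β₆)))
      (solve 3 (λ b d x →
        let β₂ = b :^ 2 :- 12 :× x
            β₄ = b :* d :- x :* β₂ :- 6 :× (x :^ 2)
            β₆ = d :^ 2 :- 2 :× (x :* β₄) :- x :^ 2 :* β₂ :- 4 :× (x :^ 3)
            β₈ = :- (3 :× (x :* β₆)) :- 3 :× (x :^ 2 :* β₄) :- x :^ 3 :* β₂ :- 3 :× (x :^ 4)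
        in
        :- (β₂ :^ 2 :* β₈) :- 8 :× (β₄ :^ 3) :- 27 :× (β₆ :^ 2) :+ 9 :× (β₂ :* β₄ :* β₆)
        := d :^ 3 :* (b :^ 3 :- 27 :× d))
        refl b d x)

-- The second flex once the first is at the origin.

module FlexPairs {c ℓ : Level} (F : FiniteField c ℓ)
                 (W : WeierstrassCurves.WeierstrassCurve F) where

  open FiniteField F
  open FieldProperties F
  open WeierstrassCurves F
  open WeierstrassCurve W
  open Flexes F W
  open IntegerSolver commutativeRing

  module _ {x₁ y₁ l₁ x₂ y₂ l₂} (f₁ : Flex x₁ y₁ l₁) (f₂ : Flex x₂ y₂ l₂) where

    open Flex f₁
    open Flex f₂ renaming
      (onCurve to onCurve′; tangent to tangent′; triple to triple′; denom≉0 to denom′≉0)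
    open FlexInvariants f₁

    translated : WeierstrassCurve
    translated = weierstrass b 0# d 0# 0#

    X Y L : Carrier
    X = x₂ - x₁
    Y = y₂ - y₁ - l₁ * X
    L = l₂ - l₁

    -- The substitution x = X + x₁, y = Y + l₁X + y₁ preserves flexes: each field is that of `f₂`,
    -- corrected by multiples of the relations for `f₁`.
    translatedFlex : Flexes.Flex F translated X Y L
    translatedFlex = record
      { onCurve = modulo (sym onCurve) (modulo onCurve′ (modulo tangent (modulo triple
          (solve 11 (λ y₂ y₁ a₆ a₄ a₃ a₂ l₂ x₂ x₁ a₁ l₁ →
            let X = x₂ :- x₁
                Y = y₂ :- y₁ :- l₁ :* X
                module C = CurvePolynomials a₁ a₂ a₃ a₄ a₆
                d = C.denomᵖ x₁ y₁
                module T = CurvePolynomials (a₁ :+ 2 :× l₁) (con (+ 0)) d (con (+ 0)) (con (+ 0))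
            in
            T.curveˡ X Y := T.curveʳ X Y
              :+ con (+ 1) :* (C.curveʳ x₁ y₁ :- C.curveˡ x₁ y₁)
              :+ con (+ 1) :* (C.curveˡ x₂ y₂ :- C.curveʳ x₂ y₂)
              :+ (:- X) :* (l₁ :* d :- C.numerᵖ x₁ y₁)
              :+ (:- (X :^ 2)) :* (C.tripleᵖ l₁ x₁ :- x₁))
          refl y₂ y₁ a₆ a₄ a₃ a₂ l₂ x₂ x₁ a₁ l₁))))
      ; denom≉0 = denom′≉0 ∘ trans (solve 7 (λ a₁ a₃ x₁ y₁ l₁ x₂ y₂ →
            let X = x₂ :- x₁
                Y = y₂ :- y₁ :- l₁ :* X
            in
            2 :× y₂ :+ a₁ :* x₂ :+ a₃
            := 2 :× Y :+ (a₁ :+ 2 :× l₁) :* X :+ (2 :× y₁ :+ a₁ :* x₁ :+ a₃))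
          refl a₁ a₃ x₁ y₁ l₁ x₂ y₂)
      ; tangent = modulo tangent′ (modulo (sym tangent) (modulo triple
          (solve 11 (λ y₂ y₁ a₆ a₄ a₃ a₂ l₂ x₂ x₁ a₁ l₁ →
            let X = x₂ :- x₁
                Y = y₂ :- y₁ :- l₁ :* X
                module C = CurvePolynomials a₁ a₂ a₃ a₄ a₆
                d = C.denomᵖ x₁ y₁
                module T = CurvePolynomials (a₁ :+ 2 :× l₁) (con (+ 0)) d (con (+ 0)) (con (+ 0))
            in
            (l₂ :- l₁) :* T.denomᵖ X Y := T.numerᵖ X Y
              :+ con (+ 1) :* (l₂ :* C.denomᵖ x₂ y₂ :- C.numerᵖ x₂ y₂)
              :+ con (+ 1) :* (C.numerᵖ x₁ y₁ :- l₁ :* d)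
              :+ (con -[1+ 1 ] :* X) :* (C.tripleᵖ l₁ x₁ :- x₁))
          refl y₂ y₁ a₆ a₄ a₃ a₂ l₂ x₂ x₁ a₁ l₁)))
      ; triple = modulo triple′ (modulo (sym triple)
          (solve 6 (λ a₁ a₂ l₁ l₂ x₁ x₂ →
            let X = x₂ :- x₁
                module C = CurvePolynomials a₁ a₂ (con (+ 0)) (con (+ 0)) (con (+ 0))
                module T = CurvePolynomials (a₁ :+ 2 :× l₁) (con (+ 0)) (con (+ 0)) (con (+ 0)) (con (+ 0))
            in
            T.tripleᵖ (l₂ :- l₁) X := X
              :+ con (+ 1) :* (C.tripleᵖ l₂ x₂ :- x₂)
              :+ con (+ 1) :* (x₁ :- C.tripleᵖ l₁ x₁))
          refl a₁ a₂ l₁ l₂ x₁ x₂))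
      }

    -- On the translated curve the 3-division polynomial is 3X⁴ + b²X³ + 3bdX² + 3d²X. Put d = zX
    -- and cancel X³.
    slope-quadratic : X ≉ 0# → let z = d / X in
      b ^ 2 + 3 · (b * z) + 3 · (z ^ 2) + 3 · X ≈ 0#
    slope-quadratic X≉0 = *-cancelʳ-0 (^-≉0 3 X≉0)
      (modulo (Flexes.FlexInvariants.b₈-flex F translated translatedFlex)
      (modulo (/-cancel d X≉0)
      (solve 4 (λ b d X z →
        let open CurvePolynomials b (con (+ 0)) d (con (+ 0)) (con (+ 0)) in
        (b :^ 2 :+ 3 :× (b :* z) :+ 3 :× (z :^ 2) :+ 3 :× X) :* X :^ 3 := con (+ 0)
        :+ con (+ 1) :* (b₈ᵖ :- (:- (3 :× (X :* b₆ᵖ)) :- 3 :× (X :^ 2 :* b₄ᵖ)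
                                   :- X :^ 3 :* b₂ᵖ :- 3 :× (X :^ 4)))
        :+ X :* (3 :× (b :* X) :+ 3 :× (z :* X :+ d)) :* (z :* X :- d))
      refl b d X (d / X))))

-- Consequences of a primitive cube root of unity.

module Family {c ℓ : Level} (F : FiniteField c ℓ)
              (ρ : FiniteField.Carrier F) (prim : FiniteField.PrimitiveRoot F 3 ρ) where

  open FiniteField F
  open FieldProperties F
  open WeierstrassCurves F
  open IntegerSolver commutativeRing

  ρ-1≉0 : ρ - 1# ≉ 0#
  ρ-1≉0 = -≉0 (proj₂ prim 1 z<s (s<s z<s) ∘ trans (*-identityʳ ρ))

  cyclotomic : ρ ^ 2 + ρ + 1# ≈ 0#
  cyclotomic = *-cancelʳ-0 ρ-1≉0 (modulo (proj₁ prim)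
    (solve 1 (λ ρ → (ρ :^ 2 :+ ρ :+ con (+ 1)) :* (ρ :- con (+ 1)) := con (+ 0)
      :+ con (+ 1) :* (ρ :^ 3 :- con (+ 1))) refl ρ))

  -- Since ρ² + ρ + 1 = 0, (ρ - 1)² = -3ρ, which would vanish in characteristic 3.
  3≉0 : 3 · 1# ≉ 0#
  3≉0 3≈0 = *-≉0 ρ-1≉0 ρ-1≉0 (modulo cyclotomic (modulo 3≈0
    (solve 1 (λ ρ → (ρ :- con (+ 1)) :* (ρ :- con (+ 1)) := con (+ 0)
      :+ con (+ 1) :* (ρ :^ 2 :+ ρ :+ con (+ 1) :- con (+ 0))
      :+ (:- ρ) :* (3 :× con (+ 1) :- con (+ 0))) refl ρ)))

  -- (ρ + 2)(1 - ρ) = 3.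
  ρ+2≉0 : ρ + 2 · 1# ≉ 0#
  ρ+2≉0 ρ+2≈0 = 3≉0 (modulo cyclotomic (modulo ρ+2≈0
    (solve 1 (λ ρ → 3 :× con (+ 1) := con (+ 0)
      :+ con (+ 1) :* (ρ :^ 2 :+ ρ :+ con (+ 1) :- con (+ 0))
      :+ (con (+ 1) :- ρ) :* (ρ :+ 2 :× con (+ 1) :- con (+ 0))) refl ρ)))

  -- (2ρ + 1)² = -3.
  2ρ+1≉0 : 2 · ρ + 1# ≉ 0#
  2ρ+1≉0 2ρ+1≈0 = 3≉0 (modulo cyclotomic (modulo 2ρ+1≈0
    (solve 1 (λ ρ → 3 :× con (+ 1) := con (+ 0)
      :+ con (+ 4) :* (ρ :^ 2 :+ ρ :+ con (+ 1) :- con (+ 0))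
      :+ (:- (2 :× ρ :+ con (+ 1))) :* (2 :× ρ :+ con (+ 1) :- con (+ 0))) refl ρ)))

  -- The curves of the family and two of their flexes.

  θ : Carrier
  θ = (ρ + 1#) / (3 · 1#)

  3θ : θ * (3 · 1#) ≈ ρ + 1#
  3θ = /-cancel _ 3≉0

  τ : Carrier
  τ = ρ / (3 · 1#)

  3τ : τ * (3 · 1#) ≈ ρ
  3τ = /-cancel _ 3≉0

  -- `X`, `Y` and `L` mirror the data of `secondFlex`; `S` and `T` are the differences of the two
  -- sides of `cyclotomic` and `3θ`.
  module FamilyPolynomials {n} (a ρ θ : Polynomial n) where
    m X Y L S T : Polynomial n
    m = a :- θ
    X = :- (3 :× (a :* m))
    Y = 3 :× ((ρ :+ 2 :× con (+ 1)) :* a :^ 2 :* m)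
    L = :- (3 :× ((ρ :+ con (+ 1)) :* a))
    S = ρ :^ 2 :+ ρ :+ con (+ 1) :- con (+ 0)
    T = θ :* (3 :× con (+ 1)) :- (ρ :+ con (+ 1))
    open CurvePolynomials (3 :× a :- con (+ 1)) (con (+ 0)) (a :* (ρ :- con (+ 1)) :* m)
           (con (+ 0)) (con (+ 0)) public

  module _ (a : Carrier) (adm : Admissible ρ a) where

    open WeierstrassCurve (family ρ a) using (a₁; a₃)
    open Flexes F (family ρ a)

    a≉0 : a ≉ 0#
    a≉0 = *-≉0⁻ˡ (*-≉0⁻ˡ adm)

    a-θ≉0 : a - θ ≉ 0#
    a-θ≉0 = *-≉0⁻ʳ (*-≉0⁻ˡ adm)

    3a-ρ≉0 : 3 · a - ρ ≉ 0#
    3a-ρ≉0 3a-ρ≈0 = *-≉0 (*-≉0⁻ʳ adm) 3≉0 (modulo 3a-ρ≈0 (modulo (sym 3τ)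
      (solve 3 (λ a ρ τ → (a :- τ) :* (3 :× con (+ 1)) := con (+ 0)
        :+ con (+ 1) :* (3 :× a :- ρ :- con (+ 0))
        :+ con (+ 1) :* (ρ :- τ :* (3 :× con (+ 1)))) refl a ρ τ)))

    -- The x-axis meets y² + a₁xy + a₃y = x³ where x³ = 0.
    originFlex : Flex 0# 0# 0#
    originFlex = record
      { onCurve = solve 2 (λ a₁ a₃ →
          let open CurvePolynomials a₁ O a₃ O O in curveˡ O O := curveʳ O O) refl a₁ a₃
      ; denom≉0 = *-≉0 (*-≉0 a≉0 ρ-1≉0) a-θ≉0 ∘ trans (solve 2 (λ a₁ a₃ →
          let open CurvePolynomials a₁ O a₃ O O in a₃ := denomᵖ O O) refl a₁ a₃)
      ; tangent = solve 2 (λ a₁ a₃ →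
          let open CurvePolynomials a₁ O a₃ O O in O :* denomᵖ O O := numerᵖ O O) refl a₁ a₃
      ; triple  = solve 2 (λ a₁ a₃ →
          let open CurvePolynomials a₁ O a₃ O O in tripleᵖ O O := O) refl a₁ a₃
      }
      where
      O : ∀ {n} → Polynomial n
      O = con (+ 0)

    -- The abscissa is 3d / ((3a - ρ) - b) for b, d at the origin, cf. b + 3z above.
    secondFlex : Flex (- (3 · (a * (a - θ)))) (3 · ((ρ + 2 · 1#) * a ^ 2 * (a - θ))) (- (3 · ((ρ + 1#) * a)))
    secondFlex = record
      { onCurve = modulo cyclotomic (modulo 3θ (solve 3 (λ a ρ θ →
          let open FamilyPolynomials a ρ θ in
          curveˡ X Y := curveʳ X Y
            :+ (a :^ 2 :* m :^ 2 :* (9 :× (a :^ 2) :+ 3 :× a)) :* S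
            :+ (:- (9 :× (a :^ 3 :* m :^ 2))) :* T) refl a ρ θ))
      ; denom≉0 = *-≉0 (*-≉0 (*-≉0 a≉0 a-θ≉0) 2ρ+1≉0) 3a-ρ≉0 ∘ trans
          (modulo (sym cyclotomic) (solve 3 (λ a ρ θ →
          let open FamilyPolynomials a ρ θ in
          a :* m :* (2 :× ρ :+ con (+ 1)) :* (3 :× a :- ρ) := denomᵖ X Y
            :+ (2 :× (a :* m)) :* (con (+ 0) :- (ρ :^ 2 :+ ρ :+ con (+ 1)))) refl a ρ θ))
      ; tangent = modulo cyclotomic (modulo 3θ (solve 3 (λ a ρ θ →
          let open FamilyPolynomials a ρ θ in
          L :* denomᵖ X Y := numerᵖ X Y
            :+ (:- (a :^ 2 :* m :* (18 :× a :+ con (+ 3)))) :* S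
            :+ (9 :× (a :^ 2 :* m)) :* T) refl a ρ θ))
      ; triple = modulo cyclotomic (modulo 3θ (solve 3 (λ a ρ θ →
          let open FamilyPolynomials a ρ θ in
          tripleᵖ L X := X
            :+ (9 :× (a :^ 2)) :* S
            :+ (:- (3 :× a)) :* T) refl a ρ θ))
      }

    family-elliptic : Elliptic (family ρ a)
    family-elliptic = *-≉0 (^-≉0 3 denom≉0) (^-≉0 3 3a-ρ≉0 ∘ trans cube) ∘ trans (sym Δ-flex)
      where
      open Flex originFlex
      open FlexInvariants originFlex
      -- With 3θ = ρ + 1 the right side is 27a³ - 27ρa² + 9ρ²a - 1 up to ρ³ = 1, and its last term
      -- is -ρ³.
      cube : (3 · a - ρ) ^ 3 ≈ b ^ 3 - 27 · d
      cube = modulo (sym (proj₁ prim)) (modulo (sym 3θ) (solve 3 (λ a ρ θ →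
        let O  = con (+ 0)
            a₁ = 3 :× a :- con (+ 1)
            open CurvePolynomials a₁ O (a :* (ρ :- con (+ 1)) :* (a :- θ)) O O
        in
        (3 :× a :- ρ) :^ 3 := (a₁ :+ 2 :× O) :^ 3 :- 27 :× denomᵖ O O
          :+ con (+ 1) :* (con (+ 1) :- ρ :^ 3)
          :+ (9 :× (a :* (ρ :- con (+ 1))))
               :* (ρ :+ con (+ 1) :- θ :* (3 :× con (+ 1)))) refl a ρ θ))

    -- Cyclicity would make the abscissae 0 and -3a(a - θ) of the two flexes equal.
    family-noncyclic : NonCyclicTorsion 3 (family ρ a)
    family-noncyclic cyclic = *-≉0 3≉0 (*-≉0 a≉0 a-θ≉0)
      (trans (solve 2 (λ a m → 3 :× con (+ 1) :* (a :* m) := con (+ 0) :- :- (3 :× (a :* m))) refl a (a - θ))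
             (RingProperties.x≈y⇒x∙y⁻¹≈ε ring (cyclic⇒x≈ cyclic originFlex secondFlex)))

  -- From a curve with two flexes to its parameter in the family.

  module _ (E : WeierstrassCurve) (elliptic : Elliptic E) where

    open WeierstrassCurve E
    open Flexes F E
    open FlexPairs F E

    module _ {x₁ y₁ l₁ x₂ y₂ l₂}
             (f₁ : Flex x₁ y₁ l₁) (x₂≉x₁ : x₂ ≉ x₁) (f₂ : Flex x₂ y₂ l₂) where

      open Flex f₁
      open FlexInvariants f₁

      x : Carrier
      x = X f₁ f₂

      x≉0 : x ≉ 0#
      x≉0 = -≉0 x₂≉x₁

      -- `a` solves u(3a - 1) = b. Then u(3a - ρ) = b + u(1 - ρ), which is to be b + 3z; as (ρ +
      -- 2)(1 - ρ) = 3, this gives `u`.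
      z u a : Carrier
      z = d / x
      u = (ρ + 2 · 1#) * z
      a = (b + u) / (3 · u)

      zx≈d : z * x ≈ d
      zx≈d = /-cancel d x≉0

      z≉0 : z ≉ 0#
      z≉0 = *-≉0⁻ˡ (denom≉0 ∘ trans (sym zx≈d))

      u≉0 : u ≉ 0#
      u≉0 = *-≉0 ρ+2≉0 z≉0

      3u≉0 : 3 · u ≉ 0#
      3u≉0 = *-≉0 3≉0 u≉0 ∘ trans
        (solve 1 (λ u → 3 :× con (+ 1) :* u := 3 :× u) refl u)

      3ua : a * (3 · u) ≈ b + u
      3ua = /-cancel (b + u) 3u≉0

      b+3z≉0 : b + 3 · z ≉ 0#
      b+3z≉0 = *-≉0⁻ˡ (*-≉0⁻ʳ (elliptic ∘ trans Δ-flex ∘ trans (*-congˡ cube)))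
        where
        -- (b + 3z)³ = b³ + 9z(b² + 3bz + 3z²) + 27z³ - 27z³ - 0, where the bracket is -3x by
        -- `slope-quadratic` and zx = d.
        cube : b ^ 3 - 27 · d ≈ (b + 3 · z) ^ 3
        cube = modulo (slope-quadratic f₁ f₂ x≉0) (modulo zx≈d
          (solve 4 (λ b d x z → b :^ 3 :- 27 :× d := (b :+ 3 :× z) :^ 3
            :+ (:- (9 :× z)) :* (b :^ 2 :+ 3 :× (b :* z) :+ 3 :× (z :^ 2) :+ 3 :× x :- con (+ 0))
            :+ con (+ 27) :* (z :* x :- d))
          refl b d x z))

      -- Times 9, by 3ua = b + u and 3θ = ρ + 1, the left side is u(ρ - 1)(b + u)(b - ρu). Here u(ρ
      -- - 1) = -3z, and (b + u)(b - ρu) = b² + 3bz + 3z² = -3x, so the product is 9zx = 9d.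
      a₃-scaled : u ^ 3 * (a * (ρ - 1#) * (a - θ)) ≈ d
      a₃-scaled = *-cancelʳ (*-≉0 3≉0 3≉0)
        (modulo 3ua (modulo 3θ (modulo cyclotomic (modulo (slope-quadratic f₁ f₂ x≉0) (modulo zx≈d
        (solve 7 (λ a θ x d b z ρ →
          let 1ᵖ = con (+ 1)
              3ᵖ = 3 :× con (+ 1)
              u  = (ρ :+ 2 :× 1ᵖ) :* z
              A  = a :* (3 :× u)
              B  = b :+ u
              T  = θ :* 3ᵖ
              S  = ρ :^ 2 :+ ρ :+ 1ᵖ
              M  = b :^ 2 :+ 3 :× (b :* z) :+ 3 :× (z :^ 2)
              N  = z :* b :+ (ρ :+ con (+ 3)) :* z :^ 2
          in
          u :^ 3 :* (a :* (ρ :- 1ᵖ) :* (a :- θ)) :* (3ᵖ :* 3ᵖ) := d :* (3ᵖ :* 3ᵖ)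
            :+ (u :* (ρ :- 1ᵖ) :* (A :+ B :- u :* T)) :* (A :- B)
            :+ (:- (u :* (ρ :- 1ᵖ) :* u :* B)) :* (T :- (ρ :+ 1ᵖ))
            :+ (z :* (M :- S :* N :+ 3 :× N)) :* (S :- con (+ 0))
            :+ (:- (3 :× z)) :* (M :+ 3 :× x :- con (+ 0))
            :+ con (+ 9) :* (z :* x :- d))
        refl a θ x d b z ρ))))))

      -- The factors a and a - θ divide `d` by `a₃-scaled`, and d ≠ 0. The factor a - τ is nonzero
      -- because u(3a - ρ) = b + 3z, which is nonzero by the discriminant.
      admissible : Admissible ρ a
      admissible = *-≉0 (*-≉0 (*-≉0⁻ˡ (*-≉0⁻ˡ fam≉0)) (*-≉0⁻ʳ fam≉0)) a-τ≉0
        where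
        fam≉0 : a * (ρ - 1#) * (a - θ) ≉ 0#
        fam≉0 = *-≉0⁻ʳ (denom≉0 ∘ trans (sym a₃-scaled))
        a-τ≉0 : a - τ ≉ 0#
        a-τ≉0 a-τ≈0 = b+3z≉0
          (modulo cyclotomic (modulo 3ua (modulo a-τ≈0 (modulo 3τ
          (solve 5 (λ a τ b z ρ →
            let u = (ρ :+ 2 :× con (+ 1)) :* z
                A = a :* (3 :× u)
            in
            b :+ 3 :× z := con (+ 0)
              :+ z :* (ρ :^ 2 :+ ρ :+ con (+ 1) :- con (+ 0))
              :+ con -[1+ 0 ] :* (A :- (b :+ u))
              :+ (3 :× u) :* (a :- τ :- con (+ 0))
              :+ u :* (τ :* (3 :× con (+ 1)) :- ρ))
          refl a τ b z ρ)))))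

      isomorphism : E ≅ family ρ a
      isomorphism = record
        -- The translation part moves the first flex to the origin with horizontal tangent. Then a₂,
        -- a₄ and a₆ vanish by triple contact, tangency and incidence, while a₁ and a₃ become `b`
        -- and `d`.
        { u = u ; r = x₁ ; s = l₁ ; t = y₁ ; u≉0 = u≉0
        ; a₁-eq = modulo 3ua (solve 3 (λ a b u →
            u :* (3 :× a :- con (+ 1)) := b :+ con (+ 1) :* (a :* (3 :× u) :- (b :+ u)))
            refl a b u)
        ; a₂-eq = modulo triple (solve 5 (λ u a₁ a₂ x l →
            let open CurvePolynomials a₁ a₂ (con (+ 0)) (con (+ 0)) (con (+ 0)) in
            u :^ 2 :* con (+ 0) := a₂ :- l :* a₁ :+ 3 :× x :- l :^ 2
              :+ con (+ 1) :* (tripleᵖ l x :- x))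
            refl u a₁ a₂ x₁ l₁)
        ; a₃-eq = trans a₃-scaled (solve 4 (λ a₁ a₃ x y →
            2 :× y :+ a₁ :* x :+ a₃ := a₃ :+ x :* a₁ :+ 2 :× y) refl a₁ a₃ x₁ y₁)
        ; a₄-eq = modulo tangent (solve 8 (λ u a₁ a₂ a₃ a₄ x y l →
            let open CurvePolynomials a₁ a₂ a₃ a₄ (con (+ 0)) in
            u :^ 4 :* con (+ 0)
            := a₄ :- l :* a₃ :+ 2 :× (x :* a₂) :- (y :+ x :* l) :* a₁ :+ 3 :× (x :^ 2) :- 2 :× (l :* y)
              :+ con (+ 1) :* (l :* denomᵖ x y :- numerᵖ x y))
            refl u a₁ a₂ a₃ a₄ x₁ y₁ l₁)
        ; a₆-eq = modulo onCurve (solve 8 (λ u a₁ a₂ a₃ a₄ a₆ x y →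
            let open CurvePolynomials a₁ a₂ a₃ a₄ a₆ in
            u :^ 6 :* con (+ 0)
            := a₆ :+ x :* a₄ :+ x :^ 2 :* a₂ :+ x :^ 3 :- y :* a₃ :- y :^ 2 :- x :* y :* a₁
              :+ con (+ 1) :* (curveˡ x y :- curveʳ x y))
            refl u a₁ a₂ a₃ a₄ a₆ x₁ y₁)
        }

    isomorphic-to-family : NonCyclicTorsion 3 E → ∃[ a ] (Admissible ρ a × E ≅ family ρ a)
    isomorphic-to-family noncyclic =
      let _ , _ , _ , _ , _ , _ , f₁ , x₂≉x₁ , f₂ = noncyclic⇒flexes noncyclic
      in a f₁ x₂≉x₁ f₂ , admissible f₁ x₂≉x₁ f₂ , isomorphism f₁ x₂≉x₁ f₂

proposition7 : ∀ {c ℓ} (F : FiniteField c ℓ) →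
    let open FiniteField F
        open WeierstrassCurves F
    in
    order % 3 ≡ 1 →
    (ρ : Carrier) → PrimitiveRoot 3 ρ →
    (∀ a → Admissible ρ a →
       Elliptic (family ρ a) × NonCyclicTorsion 3 (family ρ a))
    ×
    (∀ (E : WeierstrassCurve) → Elliptic E → NonCyclicTorsion 3 E →
       ∃[ a ] (Admissible ρ a × E ≅ family ρ a))
proposition7 F _ ρ prim =
  (λ a adm → family-elliptic a adm , family-noncyclic a adm) , isomorphic-to-family
  where open Family F ρ prim
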